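{- For all formulas $\alpha,\beta\in\tilde F$: $\alpha\vdash_{K_{im}}\beta$ if and only if $\alpha\vDash_{K_{im}}\beta$, and $\alpha\vdash_{K_{im-\vee}}\beta$ if and only if $\alpha\vDash_{K_{im-\vee}}\beta$. That is, $K_{im}$ (respectively $K_{im-\vee}$) is sound and complete with respect to the class of $K_{im}$-algebras (respectively $K_{im-\vee}$-algebras).
   Context: $\tilde F$ is the set of formulas built from propositional variables and constants $\top,\bot$ with $\wedge,\vee,\neg,\sim$. $K_{im}$ is the sequent logic (sequents are pairs $\alpha\vdash\beta$ of formulas) with axioms and rules (premises / conclusion): A1 $\alpha\vdash\alpha$; A2 $\alpha\vdash\beta,\ \beta\vdash\gamma$ / $\alpha\vdash\gamma$; A3 $\alpha\wedge\beta\vdash\alpha$, $\alpha\wedge\beta\vdash\beta$; A4 $\alpha\vdash\beta,\ \alpha\vdash\gamma$ / $\alpha\vdash\beta\wedge\gamma$; A5 $\alpha\vdash\gamma,\ \beta\vdash\gamma$ / $\alpha\vee\beta\vdash\gamma$; A6 $\alpha\vdash\alpha\vee\beta$, $\beta\vdash\alpha\vee\beta$; A7 $\alpha\wedge(\beta\vee\gamma)\vdash(\alpha\wedge\beta)\vee(\alpha\wedge\gamma)$; A8 $\alpha\vdash\top$; A9 $\bot\vdash\alpha$; A10 $\alpha\vdash\beta$ / $\neg\beta\vdash\neg\alpha$; A11 $\neg\alpha\wedge\neg\beta\vdash\neg(\alpha\vee\beta)$; A12 $\top\vdash\neg\bot$; A13 $\alpha\vdash\neg\neg\alpha$; A14 $\alpha\wedge\beta\vdash\gamma$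 / $\alpha\wedge\neg\gamma\vdash\neg\beta$; A15 $\alpha\wedge\neg\alpha\vdash\beta$; A16 $\sim\alpha\vdash\neg(\alpha\wedge\neg\sim\top)$; A17 $\neg(\alpha\wedge\neg\sim\top)\vdash\sim\alpha$. $K_{im-\vee}$ adds A18 $\top\vdash\alpha\vee\sim\alpha$. $\alpha\vdash_{K}\beta$ means the sequent is derivable in $K$. On a bounded distributive lattice $(A,1,0,\vee,\wedge)$, a unary operation $n$ is a preminimal negation if $a\leq b\Rightarrow nb\leq na$, $na\wedge nb\leq n(a\vee b)$ and $n0=1$; a minimal negation if moreover $a\leq nna$ and $a\wedge b\leq c\Rightarrow a\wedge nc\leq nb$; an intuitionistic negation if moreover $a\wedge na\leq b$ for all $a,b$. A $K_{im}$-algebra is $(A,1,0,\vee,\wedge,\neg,\sim)$ with $(A,1,0,\vee,\wedge)$ a bounded distributive lattice, $\neg$ an intuitionistic negation, $\sim$ a minimal negation, and $\neg\neg\sim1=\sim1$. A $K_{im-\vee}$-algebra is a $K_{im}$-algebra with $a\vee\sim a=1$ for all $a$. Valuations are maps from variables to $A$, extended homomorphically to $\tilde F$. $\alpha\vDash_{K_{im}}\beta$ (resp. $\alpha\vDash_{K_{im-\vee}}\beta$) means: in every $K_{im}$-algebra (resp. $K_{im-\vee}$-algebra), for every valuation $v$, $v(\alpha)=1$ implies $v(\beta)=1$. -}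

module Defs where

open import Level using (Level; suc; _⊔_)
open import Relation.Binary.Lattice.Bundles using (BoundedLattice)
import Algebra.Definitions as AlgebraicLaws

-- Algebras are setoid based, as in the standard library: the equality of an
-- algebra is the equivalence _≈_ (antisymmetry of _≤_ holds up to _≈_).
-- Unary negations respect _≈_ automatically, because they are antitone.

record BoundedDistributiveLattice (c ℓ₁ ℓ₂ : Level) : Set (suc (c ⊔ ℓ₁ ⊔ ℓ₂)) where
  field
    boundedLattice : BoundedLattice c ℓ₁ ℓ₂
  open BoundedLattice boundedLattice public
  open AlgebraicLaws _≈_ using (_DistributesOverˡ_)
  field
    ∧-distribˡ-∨ : _∧_ DistributesOverˡ _∨_

module _ {c ℓ₁ ℓ₂ : Level} (L : BoundedDistributiveLattice c ℓ₁ ℓ₂) where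
  open BoundedDistributiveLattice L

  record IsPreminimalNegation (n : Carrier → Carrier) : Set (c ⊔ ℓ₁ ⊔ ℓ₂) where
    field
      antitone : ∀ {a b} → a ≤ b → n b ≤ n a
      n-∨      : ∀ a b → (n a ∧ n b) ≤ n (a ∨ b)
      n⊥≈⊤     : n ⊥ ≈ ⊤

  record IsMinimalNegation (n : Carrier → Carrier) : Set (c ⊔ ℓ₁ ⊔ ℓ₂) where
    field
      isPreminimalNegation : IsPreminimalNegation n
      a≤nna                : ∀ a → a ≤ n (n a)
      contrapose           : ∀ {a b d} → (a ∧ b) ≤ d → (a ∧ n d) ≤ n b
    open IsPreminimalNegation isPreminimalNegation public

  record IsIntuitionisticNegation (n : Carrier → Carrier) : Set (c ⊔ ℓ₁ ⊔ ℓ₂) where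
    field
      isMinimalNegation : IsMinimalNegation n
      explosion         : ∀ a b → (a ∧ n a) ≤ b
    open IsMinimalNegation isMinimalNegation public

record KimAlgebra (c ℓ₁ ℓ₂ : Level) : Set (suc (c ⊔ ℓ₁ ⊔ ℓ₂)) where
  infix 8 ¬_ ∼_
  field
    boundedDistributiveLattice : BoundedDistributiveLattice c ℓ₁ ℓ₂
  open BoundedDistributiveLattice boundedDistributiveLattice public
  field
    ¬_                : Carrier → Carrier
    ∼_                : Carrier → Carrier
    ¬-intuitionistic  : IsIntuitionisticNegation boundedDistributiveLattice ¬_
    ∼-minimal         : IsMinimalNegation boundedDistributiveLattice ∼_
    ¬¬∼⊤≈∼⊤           : ¬ (¬ (∼ ⊤)) ≈ ∼ ⊤

record Kim∨Algebra (c ℓ₁ ℓ₂ : Level) : Set (suc (c ⊔ ℓ₁ ⊔ ℓ₂)) where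
  field
    kimAlgebra : KimAlgebra c ℓ₁ ℓ₂
  open KimAlgebra kimAlgebra public
  field
    a∨∼a≈⊤ : ∀ a → (a ∨ (∼ a)) ≈ ⊤

infix  8 ¬_ ∼_
infixr 7 _∧_
infixr 6 _∨_

data Formula (Var : Set) : Set where
  var     : Var → Formula Var
  ⊤ ⊥     : Formula Var
  _∧_ _∨_ : Formula Var → Formula Var → Formula Var
  ¬_ ∼_   : Formula Var → Formula Var

data Logic : Set where
  Kim Kim∨ : Logic

infix 4 _⊢[_]_

-- Every constructor except A18 is available in both logics.
data _⊢[_]_ {Var : Set} : Formula Var → Logic → Formula Var → Set where
  A1  : ∀ {K α} → α ⊢[ K ] α
  A2  : ∀ {K α β γ} → α ⊢[ K ] β → β ⊢[ K ] γ → α ⊢[ K ] γ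
  A3ˡ : ∀ {K α β} → α ∧ β ⊢[ K ] α
  A3ʳ : ∀ {K α β} → α ∧ β ⊢[ K ] β
  A4  : ∀ {K α β γ} → α ⊢[ K ] β → α ⊢[ K ] γ → α ⊢[ K ] β ∧ γ
  A5  : ∀ {K α β γ} → α ⊢[ K ] γ → β ⊢[ K ] γ → α ∨ β ⊢[ K ] γ
  A6ˡ : ∀ {K α β} → α ⊢[ K ] α ∨ β
  A6ʳ : ∀ {K α β} → β ⊢[ K ] α ∨ β
  A7  : ∀ {K α β γ} → α ∧ (β ∨ γ) ⊢[ K ] (α ∧ β) ∨ (α ∧ γ)
  A8  : ∀ {K α} → α ⊢[ K ] ⊤
  A9  : ∀ {K α} → ⊥ ⊢[ K ] α
  A10 : ∀ {K α β} → α ⊢[ K ] β → ¬ β ⊢[ K ] ¬ α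
  A11 : ∀ {K α β} → ¬ α ∧ ¬ β ⊢[ K ] ¬ (α ∨ β)
  A12 : ∀ {K} → ⊤ ⊢[ K ] ¬ ⊥
  A13 : ∀ {K α} → α ⊢[ K ] ¬ (¬ α)
  A14 : ∀ {K α β γ} → α ∧ β ⊢[ K ] γ → α ∧ ¬ γ ⊢[ K ] ¬ β
  A15 : ∀ {K α β} → α ∧ ¬ α ⊢[ K ] β
  A16 : ∀ {K α} → ∼ α ⊢[ K ] ¬ (α ∧ ¬ (∼ ⊤))
  A17 : ∀ {K α} → ¬ (α ∧ ¬ (∼ ⊤)) ⊢[ K ] ∼ α
  A18 : ∀ {α} → ⊤ ⊢[ Kim∨ ] α ∨ ∼ α

module _ {c ℓ₁ ℓ₂ : Level} (A : KimAlgebra c ℓ₁ ℓ₂) {Var : Set} where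
  private module A = KimAlgebra A

  ⟦_⟧ : Formula Var → (Var → A.Carrier) → A.Carrier
  ⟦ var p ⟧ v = v p
  ⟦ ⊤ ⟧     v = A.⊤
  ⟦ ⊥ ⟧     v = A.⊥
  ⟦ α ∧ β ⟧ v = ⟦ α ⟧ v A.∧ ⟦ β ⟧ v
  ⟦ α ∨ β ⟧ v = ⟦ α ⟧ v A.∨ ⟦ β ⟧ v
  ⟦ ¬ α ⟧   v = A.¬ ⟦ α ⟧ v
  ⟦ ∼ α ⟧   v = A.∼ ⟦ α ⟧ v

  PreservesTruth : Formula Var → Formula Var → Set (c ⊔ ℓ₁)
  PreservesTruth α β =
    (v : Var → A.Carrier) → ⟦ α ⟧ v A.≈ A.⊤ → ⟦ β ⟧ v A.≈ A.⊤

-- The class of algebras is the one at the given universe levels; quantifying over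
-- all levels at once would not give a type in any Set.
Entails : (c ℓ₁ ℓ₂ : Level) {Var : Set} →
          Logic → Formula Var → Formula Var → Set (suc (c ⊔ ℓ₁ ⊔ ℓ₂))
Entails c ℓ₁ ℓ₂ Kim  α β = (A : KimAlgebra c ℓ₁ ℓ₂) → PreservesTruth A α β
Entails c ℓ₁ ℓ₂ Kim∨ α β =
  (A : Kim∨Algebra c ℓ₁ ℓ₂) → PreservesTruth (Kim∨Algebra.kimAlgebra A) α β

{-# OPTIONS --safe #-}

-- Soundness: a derivation of α ⊢ β gives ⟦ α ⟧ ≤ ⟦ β ⟧ in every algebra. The axioms A16
-- and A17 hold because ∼a is the pseudocomplement of a relative to ∼1, and ∼1 = ¬¬∼1.
-- Completeness: truth preservation constrains only the valuations with v(α) = 1, so the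
-- Lindenbaum algebra is taken modulo the filter generated by α, i.e. ordered by
-- x ≤ y iff α ∧ x ⊢ y. There α = 1, hence β = 1, which says α ∧ ⊤ ⊢ β. This order is
-- compatible with both negations because A14 carries the side formula α.
module Submission where

open import Defs
open import Level using (Level; Lift; lift; lower)
open import Data.Product using (_×_; _,_; proj₁; proj₂; swap)
open import Function.Base using (_∘_)
open import Function.Bundles using (_⇔_; mk⇔)
open import Relation.Binary.Lattice.Bundles using (BoundedLattice)
import Relation.Binary.Lattice.Properties.MeetSemilattice as MeetSemilatticeProperties
open import Relation.Binary.PropositionalEquality using (_≡_; refl; cong; cong₂; subst₂)

-- The link between the two negations in an algebra

module KimAlgebraProperties {c ℓ₁ ℓ₂ : Level} (A : KimAlgebra c ℓ₁ ℓ₂) where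
  private
    module A = KimAlgebra A
    module ¬ = IsIntuitionisticNegation A.¬-intuitionistic
    module ∼ = IsMinimalNegation A.∼-minimal
  open A using (_≤_; _≈_)
  open MeetSemilatticeProperties A.meetSemilattice using (∧-monotonic)

  ⊤≤⇒≈⊤ : ∀ {a} → A.⊤ ≤ a → a ≈ A.⊤
  ⊤≤⇒≈⊤ = A.antisym (A.maximum _)

  -- Contraposition at `A.⊥`: since `A.¬ A.⊥` is the top, its conjunct costs nothing.
  disjoint⇒≤¬ : ∀ {a b} → (a A.∧ b) ≤ A.⊥ → a ≤ A.¬ b
  disjoint⇒≤¬ {a} a∧b≤⊥ =
    A.trans
      (A.∧-greatest A.refl (A.trans (A.maximum a) (A.reflexive (A.Eq.sym ¬.n⊥≈⊤))))
      (¬.contrapose a∧b≤⊥)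

  a∧∼a≤∼⊤ : ∀ a → (a A.∧ (A.∼ a)) ≤ A.∼ A.⊤
  a∧∼a≤∼⊤ a = ∼.contrapose (A.x∧y≤x a A.⊤)

  -- The meet of `A.∼ a` with `a` lies below `A.∼ A.⊤`, so the further conjunct makes it
  -- contradictory.
  ∼a≤¬[a∧¬∼⊤] : ∀ a → A.∼ a ≤ A.¬ (a A.∧ (A.¬ (A.∼ A.⊤)))
  ∼a≤¬[a∧¬∼⊤] a = disjoint⇒≤¬ (A.trans
    (A.∧-greatest
      (A.trans
        (A.∧-greatest (A.trans (A.x∧y≤y _ _) (A.x∧y≤x _ _)) (A.x∧y≤x _ _))
        (a∧∼a≤∼⊤ a))
      (A.trans (A.x∧y≤y _ _) (A.x∧y≤y _ _)))
    (¬.explosion _ _))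

  ¬[a∧¬∼⊤]≤∼a : ∀ a → A.¬ (a A.∧ (A.¬ (A.∼ A.⊤))) ≤ A.∼ a
  ¬[a∧¬∼⊤]≤∼a a =
    -- With x the left-hand side, x ∧ a is disjoint from `d`, hence below ¬¬∼⊤ = ∼⊤. Contraposing
    -- for `∼` gives x ∧ ∼∼⊤ ≤ ∼a, and ∼∼⊤ is the top.
    A.trans
      (A.∧-greatest A.refl (A.trans (A.maximum _) (∼.a≤nna A.⊤)))
      (∼.contrapose (A.trans (disjoint⇒≤¬ disjoint) (A.reflexive A.¬¬∼⊤≈∼⊤)))
    where
    d : A.Carrier
    d = A.¬ (A.∼ A.⊤)

    disjoint : (((A.¬ (a A.∧ d)) A.∧ a) A.∧ d) ≤ A.⊥
    disjoint = A.trans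
      (A.∧-greatest
        (∧-monotonic (A.x∧y≤y _ _) A.refl)
        (A.trans (A.x∧y≤x _ _) (A.x∧y≤x _ _)))
      (¬.explosion _ _)

  ≤⇒PreservesTruth : ∀ {Var} {α β : Formula Var} → (∀ v → ⟦ A ⟧ α v A.≤ ⟦ A ⟧ β v) →
                     PreservesTruth A α β
  ≤⇒PreservesTruth α≤β v α≈⊤ =
    ⊤≤⇒≈⊤ (A.trans (A.reflexive (A.Eq.sym α≈⊤)) (α≤β v))

module Soundness {c ℓ₁ ℓ₂ : Level} (A : KimAlgebra c ℓ₁ ℓ₂) {Var : Set} {K : Logic} where
  private
    module A = KimAlgebra A
    module ¬ = IsIntuitionisticNegation A.¬-intuitionistic
  open KimAlgebraProperties A

  -- One induction serves both logics: excluded middle is demanded only under a proof that `K` is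
  -- `Kim∨`, which a derivation ending in `A18` supplies.
  ⊢⇒≤ : (K ≡ Kim∨ → ∀ (α : Formula Var) v → A.⊤ A.≤ ⟦ A ⟧ (α ∨ (∼ α)) v) →
        ∀ {α β : Formula Var} → α ⊢[ K ] β → ∀ v → ⟦ A ⟧ α v A.≤ ⟦ A ⟧ β v
  ⊢⇒≤ excludedMiddle = go
    where
    go : ∀ {α β : Formula Var} → α ⊢[ K ] β → ∀ v → ⟦ A ⟧ α v A.≤ ⟦ A ⟧ β v
    go A1        v = A.refl
    go (A2 p q)  v = A.trans (go p v) (go q v)
    go A3ˡ       v = A.x∧y≤x _ _
    go A3ʳ       v = A.x∧y≤y _ _
    go (A4 p q)  v = A.∧-greatest (go p v) (go q v)
    go (A5 p q)  v = A.∨-least (go p v) (go q v)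
    go A6ˡ       v = A.x≤x∨y _ _
    go A6ʳ       v = A.y≤x∨y _ _
    go A7        v = A.reflexive (A.∧-distribˡ-∨ _ _ _)
    go A8        v = A.maximum _
    go A9        v = A.minimum _
    go (A10 p)   v = ¬.antitone (go p v)
    go A11       v = ¬.n-∨ _ _
    go A12       v = A.reflexive (A.Eq.sym ¬.n⊥≈⊤)
    go A13       v = ¬.a≤nna _
    go (A14 p)   v = ¬.contrapose (go p v)
    go A15       v = ¬.explosion _ _
    go A16       v = ∼a≤¬[a∧¬∼⊤] _
    go A17       v = ¬[a∧¬∼⊤]≤∼a _
    go (A18 {α}) v = excludedMiddle refl α v

Kim-sound : ∀ {c ℓ₁ ℓ₂ Var} {α β : Formula Var} → α ⊢[ Kim ] β → Entails c ℓ₁ ℓ₂ Kim α β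
Kim-sound {α = α} {β} p A = ≤⇒PreservesTruth {α = α} {β} (⊢⇒≤ (λ ()) p)
  where
  open KimAlgebraProperties A
  open Soundness A

Kim∨-sound : ∀ {c ℓ₁ ℓ₂ Var} {α β : Formula Var} → α ⊢[ Kim∨ ] β → Entails c ℓ₁ ℓ₂ Kim∨ α β
Kim∨-sound {α = α} {β} p A =
  ≤⇒PreservesTruth {α = α} {β} (⊢⇒≤ (λ _ _ _ → reflexive (Eq.sym (a∨∼a≈⊤ _))) p)
  where
  open Kim∨Algebra A using (kimAlgebra; reflexive; module Eq; a∨∼a≈⊤)
  open KimAlgebraProperties kimAlgebra
  open Soundness kimAlgebra

-- Rules for `∼` derived from its definability by `¬`

module Derived {Var : Set} {K : Logic} where

  infix 4 _⊢_
  _⊢_ : Formula Var → Formula Var → Set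
  α ⊢ β = α ⊢[ K ] β

  private variable
    α β γ δ : Formula Var

  ∧-mono : α ⊢ γ → β ⊢ δ → α ∧ β ⊢ γ ∧ δ
  ∧-mono p q = A4 (A2 A3ˡ p) (A2 A3ʳ q)

  ∧-comm : α ∧ β ⊢ β ∧ α
  ∧-comm = A4 A3ʳ A3ˡ

  ∧-assocˡ : (α ∧ β) ∧ γ ⊢ α ∧ (β ∧ γ)
  ∧-assocˡ = A4 (A2 A3ˡ A3ˡ) (∧-mono A3ʳ A1)

  ∧-assocʳ : α ∧ (β ∧ γ) ⊢ (α ∧ β) ∧ γ
  ∧-assocʳ = A4 (∧-mono A1 A3ˡ) (A2 A3ʳ A3ʳ)

  ∧-∨-distribʳ : (α ∨ β) ∧ γ ⊢ (α ∧ γ) ∨ (β ∧ γ)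
  ∧-∨-distribʳ = A2 ∧-comm (A2 A7 (A5 (A2 ∧-comm A6ˡ) (A2 ∧-comm A6ʳ)))

  disjoint⇒⊢¬ : α ∧ β ⊢ ⊥ → α ⊢ ¬ β
  disjoint⇒⊢¬ p = A2 (A4 A1 (A2 A8 A12)) (A14 p)

  -- By `A16` and `A17`, `∼ γ` is interderivable with `¬ (γ ∧ ¬ (∼ ⊤))`. Adding the conjunct
  -- `¬ (∼ ⊤)` to both sides of the premise reduces the rule to `A14`.
  ∼-contrapose : α ∧ β ⊢ γ → α ∧ ∼ γ ⊢ ∼ β
  ∼-contrapose p =
    A2 (∧-mono A1 A16) (A2 (A14 (A2 ∧-assocʳ (∧-mono p A1))) A17)

  -- By `A17` it suffices to refute `α ∧ (∼ α ∧ ¬ (∼ ⊤))`; contraposing `α ∧ ⊤ ⊢ α` yields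
  -- `α ∧ ∼ α ⊢ ∼ ⊤`, a contradiction.
  α⊢∼∼α : α ⊢ ∼ (∼ α)
  α⊢∼∼α = A2
    (disjoint⇒⊢¬ (A2 ∧-assocʳ (A2 (∧-mono (∼-contrapose {β = ⊤} A3ˡ) A1) A15)))
    A17

  ∼-∨ : ∼ α ∧ ∼ β ⊢ ∼ (α ∨ β)
  ∼-∨ = A2 (∧-mono A16 A16) (A2 A11 (A2 (A10 ∧-∨-distribʳ) A17))

  ⊤⊢∼⊥ : ⊤ ⊢ ∼ ⊥
  ⊤⊢∼⊥ = A2 A12 (A2 (A10 A3ˡ) A17)

  ¬¬∼⊤⊢∼⊤ : ¬ (¬ (∼ ⊤)) ⊢ ∼ ⊤
  ¬¬∼⊤⊢∼⊤ = A2 (A10 A3ʳ) A17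

-- Lindenbaum algebra modulo the filter of `θ`

module Lindenbaum (c ℓ₁ ℓ₂ : Level) {Var : Set} (K : Logic) (θ : Formula Var) where
  open Derived {Var} {K}

  -- The elements are the formulas themselves; the quotient lives only in `_≈_`. `Lift` reaches the
  -- prescribed levels.
  Carrier : Set c
  Carrier = Lift c (Formula Var)

  infix 4 _≤_ _≈_

  _≤_ : Carrier → Carrier → Set ℓ₂
  lift x ≤ lift y = Lift ℓ₂ (θ ∧ x ⊢ y)

  _≈_ : Carrier → Carrier → Set ℓ₁
  lift x ≈ lift y = Lift ℓ₁ ((θ ∧ x ⊢ y) × (θ ∧ y ⊢ x))

  ⊢⇒≤ : ∀ {x y} → x ⊢ y → lift x ≤ lift y
  ⊢⇒≤ p = lift (A2 A3ʳ p)

  ⊢⊣⇒≈ : ∀ {x y} → x ⊢ y → y ⊢ x → lift x ≈ lift y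
  ⊢⊣⇒≈ p q = lift (A2 A3ʳ p , A2 A3ʳ q)

  θ-trans : ∀ {x y z} → θ ∧ x ⊢ y → θ ∧ y ⊢ z → θ ∧ x ⊢ z
  θ-trans p q = A2 (A4 A3ˡ p) q

  boundedLattice : BoundedLattice c ℓ₁ ℓ₂
  boundedLattice = record
    { Carrier = Carrier
    ; _≈_ = _≈_
    ; _≤_ = _≤_
    ; _∨_ = λ (lift x) (lift y) → lift (x ∨ y)
    ; _∧_ = λ (lift x) (lift y) → lift (x ∧ y)
    ; ⊤ = lift ⊤
    ; ⊥ = lift ⊥
    ; isBoundedLattice = record
      { isLattice = record
        { isPartialOrder = record
          { isPreorder = record
            { isEquivalence = record
              { refl  = ⊢⊣⇒≈ A1 A1
              ; sym   = λ (lift p) → lift (swap p)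
              ; trans = λ (lift (p , p′)) (lift (q , q′)) →
                          lift (θ-trans p q , θ-trans q′ p′)
              }
            ; reflexive = λ (lift (p , _)) → lift p
            ; trans     = λ (lift p) (lift q) → lift (θ-trans p q)
            }
          ; antisym = λ (lift p) (lift q) → lift (p , q)
          }
        ; supremum = λ _ _ →
            -- `A7` distributes `θ` over the disjunction, so that both hypotheses apply.
            ⊢⇒≤ A6ˡ , ⊢⇒≤ A6ʳ , λ _ (lift p) (lift q) → lift (A2 A7 (A5 p q))
        ; infimum = λ _ _ →
            ⊢⇒≤ A3ˡ , ⊢⇒≤ A3ʳ , λ _ (lift p) (lift q) → lift (A4 p q)
        }
      ; maximum = λ _ → ⊢⇒≤ A8
      ; minimum = λ _ → ⊢⇒≤ A9
      }
    }

  boundedDistributiveLattice : BoundedDistributiveLattice c ℓ₁ ℓ₂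
  boundedDistributiveLattice = record
    { boundedLattice = boundedLattice
    ; ∧-distribˡ-∨   = λ _ _ _ →
        ⊢⊣⇒≈ A7 (A5 (∧-mono A1 A6ˡ) (∧-mono A1 A6ʳ))
    }

  minimalNegation : (n : Formula Var → Formula Var) →
    (∀ {x y z} → x ∧ y ⊢ z → x ∧ n z ⊢ n y) →
    (∀ {x y} → n x ∧ n y ⊢ n (x ∨ y)) →
    ⊤ ⊢ n ⊥ →
    (∀ {x} → x ⊢ n (n x)) →
    IsMinimalNegation boundedDistributiveLattice (λ (lift x) → lift (n x))
  minimalNegation n contrapose n-∨ ⊤⊢n⊥ x⊢nnx = record
    { isPreminimalNegation = record
      -- Here `θ` itself is the side formula of the contraposition.
      { antitone = λ (lift p) → lift (contrapose p)
      ; n-∨      = λ _ _ → ⊢⇒≤ n-∨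
      ; n⊥≈⊤     = ⊢⊣⇒≈ A8 ⊤⊢n⊥
      }
    ; a≤nna      = λ _ → ⊢⇒≤ x⊢nnx
    -- Regrouping makes `θ` together with the first conjunct the side formula.
    ; contrapose = λ (lift p) →
        lift (A2 ∧-assocʳ (contrapose (A2 ∧-assocˡ p)))
    }

  kimAlgebra : KimAlgebra c ℓ₁ ℓ₂
  kimAlgebra = record
    { boundedDistributiveLattice = boundedDistributiveLattice
    ; ¬_ = λ (lift x) → lift (¬ x)
    ; ∼_ = λ (lift x) → lift (∼ x)
    ; ¬-intuitionistic = record
      { isMinimalNegation = minimalNegation ¬_ A14 A11 A12 A13
      ; explosion         = λ _ _ → ⊢⇒≤ A15
      }
    ; ∼-minimal = minimalNegation ∼_ ∼-contrapose ∼-∨ ⊤⊢∼⊥ α⊢∼∼α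
    ; ¬¬∼⊤≈∼⊤   = ⊢⊣⇒≈ ¬¬∼⊤⊢∼⊤ A13
    }

  -- Propositional equality is available because the carrier is not quotiented.
  ⟦⟧-canonical : ∀ γ → ⟦ kimAlgebra ⟧ γ (lift ∘ var) ≡ lift γ
  ⟦⟧-canonical (var p) = refl
  ⟦⟧-canonical ⊤       = refl
  ⟦⟧-canonical ⊥       = refl
  ⟦⟧-canonical (γ ∧ δ) =
    cong₂ (λ (lift x) (lift y) → lift (x ∧ y)) (⟦⟧-canonical γ) (⟦⟧-canonical δ)
  ⟦⟧-canonical (γ ∨ δ) =
    cong₂ (λ (lift x) (lift y) → lift (x ∨ y)) (⟦⟧-canonical γ) (⟦⟧-canonical δ)
  ⟦⟧-canonical (¬ γ)   = cong (λ (lift x) → lift (¬ x)) (⟦⟧-canonical γ)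
  ⟦⟧-canonical (∼ γ)   = cong (λ (lift x) → lift (∼ x)) (⟦⟧-canonical γ)

  PreservesTruth⇒⊢ : ∀ {β} → PreservesTruth kimAlgebra θ β → θ ⊢ β
  PreservesTruth⇒⊢ {β} preserves = A2 (A4 A1 A8) (proj₂ (lower β≈⊤))
    where
    β≈⊤ : lift β ≈ lift ⊤
    β≈⊤ = subst₂ (λ a b → a ≈ lift ⊤ → b ≈ lift ⊤)
      (⟦⟧-canonical θ) (⟦⟧-canonical β) (preserves (lift ∘ var))
      -- `θ` equals the top: `θ ∧ θ ⊢ ⊤` and `θ ∧ ⊤ ⊢ θ`.
      (lift (A8 , A3ˡ))

Kim-complete : ∀ {c ℓ₁ ℓ₂ Var} {α β : Formula Var} → Entails c ℓ₁ ℓ₂ Kim α β → α ⊢[ Kim ] β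
Kim-complete {c} {ℓ₁} {ℓ₂} {α = α} entails = PreservesTruth⇒⊢ (entails kimAlgebra)
  where open Lindenbaum c ℓ₁ ℓ₂ Kim α

Kim∨-complete : ∀ {c ℓ₁ ℓ₂ Var} {α β : Formula Var} → Entails c ℓ₁ ℓ₂ Kim∨ α β → α ⊢[ Kim∨ ] β
Kim∨-complete {c} {ℓ₁} {ℓ₂} {α = α} entails = PreservesTruth⇒⊢ (entails record
  { kimAlgebra = kimAlgebra
  ; a∨∼a≈⊤     = λ _ → ⊢⊣⇒≈ A8 A18
  })
  where open Lindenbaum c ℓ₁ ℓ₂ Kim∨ α

theorem6p6 : (c ℓ₁ ℓ₂ : Level) (Var : Set) (α β : Formula Var) →
    ((α ⊢[ Kim ] β) ⇔ Entails c ℓ₁ ℓ₂ Kim α β) ×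
    ((α ⊢[ Kim∨ ] β) ⇔ Entails c ℓ₁ ℓ₂ Kim∨ α β)
theorem6p6 c ℓ₁ ℓ₂ Var α β =
  mk⇔ Kim-sound Kim-complete , mk⇔ Kim∨-sound Kim∨-complete
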